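{- Let $G$ and $H$ be finite vertex-transitive graphs with $\frac{\alpha(G)}{|V(G)|}\geq\frac{\alpha(H)}{|V(H)|}$. Then \[\alpha(G\times H)=\alpha(G)\,|V(H)|,\] and at least one of the following holds: (i) $G\times H$ is MIS-normal; (ii) $\frac{\alpha(G)}{|V(G)|}=\frac{\alpha(H)}{|V(H)|}$ and at least one of $G$, $H$ is IS-imprimitive; (iii) $\frac{\alpha(G)}{|V(G)|}>\frac{\alpha(H)}{|V(H)|}$ and $H$ is disconnected.
   Context: All graphs are finite, simple and undirected; $\alpha(\cdot)$ denotes the independence number. The direct product $G\times H$ has vertex set $V(G)\times V(H)$, with $(u_1,v_1)$ adjacent to $(u_2,v_2)$ iff $u_1u_2\in E(G)$ and $v_1v_2\in E(H)$. For a subset $A\subseteq V(G)$, $N_G[A]$ denotes $A$ together with all vertices adjacent to some vertex of $A$. A nonempty independent set $A$ of $G$ is called imprimitive if $|A|<\alpha(G)$ and $\frac{|A|}{|N_G[A]|}=\frac{\alpha(G)}{|V(G)|}$; $G$ is IS-imprimitive if it has an imprimitive independent set, and IS-primitive otherwise. The product $G\times H$ is MIS-normal if every maximum independent set of $G\times H$ is of the form $I\times V(H)$ with $I$ an independent set of $G$, or $V(G)\times J$ with $J$ an independent set of $H$ (i.e. the preimage under a projection of an independent set of one factor). -}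

module Defs where

open import Data.Nat using (ℕ; zero; suc; _*_; _≤_; _<_)
open import Data.Bool using (Bool; true; false; _∧_; _∨_)
open import Data.Fin using (Fin; zero; suc; combine; remQuot)
open import Data.Fin.Subset using (Subset; _∈_; ∣_∣; Nonempty)
open import Data.Fin.Permutation using (Permutation′; _⟨$⟩ʳ_)
open import Data.Vec using (tabulate; lookup)
open import Data.Product using (Σ; ∃; _×_; _,_; proj₁; proj₂)
open import Data.Sum using (_⊎_)
open import Relation.Binary.PropositionalEquality using (_≡_; refl; cong₂)
open import Relation.Nullary using (¬_)
open import Function.Bundles using (_⇔_)

record Graph : Set where
  field
    n     : ℕ
    adj   : Fin n → Fin n → Bool
    irrefl : ∀ v → adj v v ≡ false
    sym   : ∀ u v → adj u v ≡ adj v u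
open Graph public

Independent : (G : Graph) → Subset (n G) → Set
Independent G A = ∀ u v → u ∈ A → v ∈ A → adj G u v ≡ false

IsMaxIndep : (G : Graph) → Subset (n G) → Set
IsMaxIndep G A = Independent G A × (∀ B → Independent G B → ∣ B ∣ ≤ ∣ A ∣)

IsAlpha : Graph → ℕ → Set
IsAlpha G k = Σ (Subset (n G)) λ A → IsMaxIndep G A × ∣ A ∣ ≡ k

anyFin : ∀ {m} → (Fin m → Bool) → Bool
anyFin {zero}  f = false
anyFin {suc m} f = f zero ∨ anyFin (λ i → f (suc i))

closedNbhd : (G : Graph) → Subset (n G) → Subset (n G)
closedNbhd G A = tabulate λ v → lookup A v ∨ anyFin (λ u → lookup A u ∧ adj G u v)

-- Direct (tensor) product; vertex (g , h) is encoded as combine {n G} {n H} g h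
prodAdj : (G H : Graph) → Fin (n G * n H) → Fin (n G * n H) → Bool
prodAdj G H x y =
  adj G (proj₁ (remQuot {n G} (n H) x)) (proj₁ (remQuot {n G} (n H) y))
  ∧ adj H (proj₂ (remQuot {n G} (n H) x)) (proj₂ (remQuot {n G} (n H) y))

prodAdj-irrefl : (G H : Graph) → ∀ v → prodAdj G H v v ≡ false
prodAdj-irrefl G H v rewrite irrefl G (proj₁ (remQuot {n G} (n H) v)) = refl

prodAdj-sym : (G H : Graph) → ∀ x y → prodAdj G H x y ≡ prodAdj G H y x
prodAdj-sym G H x y = cong₂ _∧_ (Graph.sym G _ _) (Graph.sym H _ _)

_×ᵍ_ : Graph → Graph → Graph
G ×ᵍ H = record
  { n = n G * n H
  ; adj = prodAdj G H
  ; irrefl = prodAdj-irrefl G H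
  ; sym = prodAdj-sym G H
  }

IsAutomorphism : (G : Graph) → Permutation′ (n G) → Set
IsAutomorphism G σ = ∀ u v → adj G (σ ⟨$⟩ʳ u) (σ ⟨$⟩ʳ v) ≡ adj G u v

VertexTransitive : Graph → Set
VertexTransitive G =
  ∀ u v → Σ (Permutation′ (n G)) λ σ → IsAutomorphism G σ × σ ⟨$⟩ʳ u ≡ v

data Walk (G : Graph) : Fin (n G) → Fin (n G) → Set where
  here : ∀ {u} → Walk G u u
  step : ∀ {u v w} → adj G u v ≡ true → Walk G v w → Walk G u w

Connected : Graph → Set
Connected G = ∀ u v → Walk G u v

Disconnected : Graph → Set
Disconnected G = ¬ Connected G

-- Imprimitive independent set A (given α(G) = a):
-- nonempty, |A| < α, and |A| / |N[A]| = α / |V|  (cross-multiplied)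
IsImprimitiveSet : (G : Graph) → ℕ → Subset (n G) → Set
IsImprimitiveSet G a A =
  Independent G A × Nonempty A × ∣ A ∣ < a
  × ∣ A ∣ * n G ≡ a * ∣ closedNbhd G A ∣

ISImprimitive : Graph → Set
ISImprimitive G = Σ ℕ λ a → IsAlpha G a × Σ (Subset (n G)) (IsImprimitiveSet G a)

MISNormal : Graph → Graph → Set
MISNormal G H = ∀ (S : Subset (n (G ×ᵍ H))) → IsMaxIndep (G ×ᵍ H) S →
    (Σ (Subset (n G)) λ I → Independent G I
        × (∀ g h → (combine {n G} {n H} g h ∈ S) ⇔ (g ∈ I)))
  ⊎ (Σ (Subset (n H)) λ J → Independent H J
        × (∀ g h → (combine {n G} {n H} g h ∈ S) ⇔ (h ∈ J)))

{-# OPTIONS --safe #-}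
-- In a vertex-transitive graph K every independent set A satisfies
-- |A| / |N[A]| ≤ α(K) / |V(K)|: replacing J ∩ N[A] by A in a maximum independent
-- set J gives |A| ≤ |J ∩ N[A]|, and one averages over all J.
--
-- Let S be independent in G × H, let A_h be the set of isolated vertices of the
-- fibre of S over h, and let D^g be the set of h such that g is a non-isolated
-- vertex of that fibre. The sets A_h and D^g are independent, and the unions of
-- N[A_h] × {h} and of {g} × N[D^g] are disjoint, so summing the ratio bounds
-- yields |S| ≤ α(G) |V(H)|. For a maximum S all these bounds are tight and the
-- two unions partition the vertices. If the two ratios differ, tightness forces
-- every D^g to be empty; if they agree and both factors are primitive, one of the
-- unions is empty. So S consists of maximum independent fibres over one factor,
-- and fibres over adjacent vertices coincide. If they are not all equal, the set
-- where the fibre takes a given value is a proper union of components, which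
-- shows that factor to be disconnected and, by the ratio bound, imprimitive.
module Submission where

open import Defs
open import Data.Nat using (ℕ; _*_; _≤_; _<_)
open import Data.Product using (_×_)
open import Data.Sum using (_⊎_)
open import Relation.Binary.PropositionalEquality using (_≡_)

open import Data.Bool using (Bool; true; false; _∧_; _∨_; not; if_then_else_)
open import Data.Bool.Properties using (¬-not; ∧-conicalˡ; ∧-conicalʳ; ∨-conicalˡ; ∨-zeroʳ) renaming (_≟_ to _≟ᵇ_)
open import Data.Empty using (⊥; ⊥-elim)
open import Data.Fin using (Fin; zero; suc; combine; remQuot; finToFun; funToFin; fromℕ<; _↑ˡ_; _↑ʳ_)
open import Data.Fin.Permutation using (Permutation′; permutation; _⟨$⟩ʳ_; _⟨$⟩ˡ_; flip; inverseʳ; inverseˡ)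
open import Data.Fin.Properties using (nonZeroIndex; all?; ¬∀⟶∃¬; finToFun-funToFin; funToFin-finToFin; 2↔Bool; remQuot-combine) renaming (_≟_ to _≟ᶠ_)
open import Data.Fin.Subset using (Subset; _∈_; ∣_∣)
open import Data.Nat using (zero; suc; _+_; _^_; z≤n; NonZero; >-nonZero)
open import Data.Nat.Properties
open import Data.Nat.Tactic.RingSolver using (solve-∀)
open import Data.Product using (Σ; ∃; _,_; proj₁; proj₂)
open import Data.Sum as Sum using (inj₁; inj₂; [_,_])
open import Data.Vec using ([]; _∷_; lookup; tabulate)
open import Data.Vec.Properties using (lookup∘tabulate; []=⇒lookup; lookup⇒[]=)
open import Function using (_∘_)
open import Function.Bundles using (module Inverse; _⇔_; mk⇔)
open import Relation.Binary.PropositionalEquality using (_≢_; _≗_; refl; trans; cong; cong₂; subst; subst₂; module ≡-Reasoning) renaming (sym to ≡-sym)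
open import Relation.Nullary using (Dec; yes; no; does)
open import Relation.Nullary.Decidable using (_×-dec_; _→-dec_; ¬?; dec-true; dec-false; does-⇔)

open import Algebra.Properties.Semiring.Sum +-*-semiring using (sum; sum-cong-≗; ∑-comm; ∑-distrib-+; sum-permute; *-distribˡ-sum; *-distribʳ-sum)

private
  variable
    m k : ℕ

-- Sums and cardinalities

sum-mono-≤ : {f g : Fin m → ℕ} → (∀ i → f i ≤ g i) → sum f ≤ sum g
sum-mono-≤ {zero}  f≤g = z≤n
sum-mono-≤ {suc m} f≤g = +-mono-≤ (f≤g zero) (sum-mono-≤ (f≤g ∘ suc))

sum-const : ∀ m c → sum {m} (λ _ → c) ≡ m * c
sum-const zero    c = refl
sum-const (suc m) c = cong (c +_) (sum-const m c)

term≤sum : (f : Fin m → ℕ) (i : Fin m) → f i ≤ sum f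
term≤sum f zero    = m≤m+n _ _
term≤sum f (suc i) = ≤-trans (term≤sum (f ∘ suc) i) (m≤n+m _ _)

+-tight : ∀ {x y p q} → x ≤ p → y ≤ q → p + q ≤ x + y → x ≡ p × y ≡ q
+-tight {x} {y} {p} {q} x≤p y≤q le =
  ≤-antisym x≤p (+-cancelʳ-≤ q p x (≤-trans le (+-monoʳ-≤ x y≤q))) ,
  ≤-antisym y≤q (+-cancelˡ-≤ p q y (≤-trans le (+-monoˡ-≤ y x≤p)))

-- Peeling off the first summand with `+-tight` leaves the reversed inequality for the tails. The
-- equality cases of the ratio bounds are extracted this way.
sum-tight : {f g : Fin m → ℕ} → (∀ i → f i ≤ g i) → sum g ≤ sum f → f ≗ g
sum-tight {suc m} f≤g le zero    = proj₁ (+-tight (f≤g zero) (sum-mono-≤ (f≤g ∘ suc)) le)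
sum-tight {suc m} f≤g le (suc i) =
  sum-tight (f≤g ∘ suc)
    (≤-reflexive (≡-sym (proj₂ (+-tight (f≤g zero) (sum-mono-≤ (f≤g ∘ suc)) le)))) i

sum-++ : ∀ m {k} (f : Fin (m + k) → ℕ) →
         sum f ≡ sum (λ i → f (i ↑ˡ k)) + sum (λ j → f (m ↑ʳ j))
sum-++ zero    f = refl
sum-++ (suc m) f = trans (cong (f zero +_) (sum-++ m (f ∘ suc))) (≡-sym (+-assoc (f zero) _ _))

-- `combine` unfolds along its first argument into `↑ˡ` on the first block and `↑ʳ` on the rest, so
-- `sum-++` splits off one row at a time.
sum-combine : ∀ m k (f : Fin (m * k) → ℕ) → sum f ≡ sum (λ i → sum (λ j → f (combine {m} {k} i j)))
sum-combine zero    k f = refl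
sum-combine (suc m) k f =
  trans (sum-++ k f) (cong (sum (λ j → f (j ↑ˡ (m * k))) +_) (sum-combine m k (λ x → f (k ↑ʳ x))))

-- Indicators and counting of Boolean predicates

ι : Bool → ℕ
ι b = if b then 1 else 0

ι≤1 : ∀ b → ι b ≤ 1
ι≤1 true  = ≤-refl
ι≤1 false = z≤n

ι-∧ : ∀ x y → ι (x ∧ y) ≡ ι x * ι y
ι-∧ true  y = ≡-sym (+-identityʳ (ι y))
ι-∧ false y = refl

ι-split : ∀ x y → ι x ≡ ι (x ∧ y) + ι (x ∧ not y)
ι-split true  true  = refl
ι-split true  false = refl
ι-split false y     = refl

ι-not : ∀ x → ι x + ι (not x) ≡ 1
ι-not true  = refl
ι-not false = refl

ι-mono : ∀ {x y} → (x ≡ true → y ≡ true) → ι x ≤ ι y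
ι-mono {true}  x⇒y rewrite x⇒y refl = ≤-refl
ι-mono {false} x⇒y = z≤n

ι-disjoint : ∀ {x y} → (x ≡ true → y ≢ true) → ι x + ι y ≤ 1
ι-disjoint {true}  {true}  x⇒¬y = ⊥-elim (x⇒¬y refl refl)
ι-disjoint {true}  {false} x⇒¬y = ≤-refl
ι-disjoint {false} {y}     x⇒¬y = ι≤1 y

ι-injective : ∀ {x y} → ι x ≡ ι y → x ≡ y
ι-injective {true}  {true}  eq = refl
ι-injective {false} {false} eq = refl

-- Allows an inequality known only for maximum independent sets to be summed over all subsets: where
-- `P` fails, both sides vanish.
does*-mono : {P : Set} (P? : Dec P) {x y : ℕ} → (P → x ≤ y) → ι (does P?) * x ≤ ι (does P?) * y
does*-mono (yes p) x≤y = *-monoʳ-≤ 1 (x≤y p)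
does*-mono (no _)  x≤y = z≤n

-- Cardinality as a sum of indicators makes double counting an exchange of summations.
#_ : (Fin m → Bool) → ℕ
# P = sum (ι ∘ P)

infix 8 #_

_∩_ _∖_ _∪_ : (P Q : Fin m → Bool) → Fin m → Bool
(P ∩ Q) i = P i ∧ Q i
(P ∖ Q) i = P i ∧ not (Q i)
(P ∪ Q) i = P i ∨ Q i

#-cong : {P Q : Fin m → Bool} → P ≗ Q → # P ≡ # Q
#-cong P≗Q = sum-cong-≗ (cong ι ∘ P≗Q)

#-mono : {P Q : Fin m → Bool} → (∀ i → P i ≡ true → Q i ≡ true) → # P ≤ # Q
#-mono P⊆Q = sum-mono-≤ (λ i → ι-mono (P⊆Q i))

#-tight : {P Q : Fin m → Bool} → (∀ i → P i ≡ true → Q i ≡ true) → # Q ≤ # P → P ≗ Q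
#-tight P⊆Q le i = ι-injective (sum-tight (λ j → ι-mono (P⊆Q j)) le i)

#≡0⇒empty : {P : Fin m → Bool} → # P ≡ 0 → ∀ i → P i ≡ false
#≡0⇒empty {P = P} eq i =
  ι-injective (n≤0⇒n≡0 (subst (ι (P i) ≤_) eq (term≤sum (ι ∘ P) i)))

full⇒#≡size : {P : Fin m → Bool} → (∀ i → P i ≡ true) → # P ≡ m
full⇒#≡size {m} P-full = trans (#-cong P-full) (trans (sum-const m 1) (*-identityʳ m))

#≡size⇒full : {P : Fin m → Bool} → # P ≡ m → ∀ i → P i ≡ true
#≡size⇒full {P = P} eq =
  #-tight (λ _ _ → refl) (≤-reflexive (trans (full⇒#≡size (λ _ → refl)) (≡-sym eq)))

∈⇒0<# : {P : Fin m → Bool} {i : Fin m} → P i ≡ true → 0 < # P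
∈⇒0<# {P = P} {i} i∈P = subst (_≤ # P) (cong ι i∈P) (term≤sum (ι ∘ P) i)

0<#⇒∈ : (P : Fin m → Bool) → 0 < # P → ∃ λ i → P i ≡ true
0<#⇒∈ {suc m} P pos with P zero in eq
... | true  = zero , eq
... | false with 0<#⇒∈ (P ∘ suc) pos
...   | i , i∈P = suc i , i∈P

#-split : (P Q : Fin m → Bool) → # P ≡ # (P ∩ Q) + # (P ∖ Q)
#-split P Q = trans (sum-cong-≗ (λ i → ι-split (P i) (Q i))) (∑-distrib-+ (ι ∘ (P ∩ Q)) (ι ∘ (P ∖ Q)))

#-complement : (P : Fin m → Bool) → # P + # (not ∘ P) ≡ m
#-complement {m} P =
  trans (≡-sym (∑-distrib-+ (ι ∘ P) (ι ∘ not ∘ P)))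
    (trans (sum-cong-≗ (ι-not ∘ P)) (trans (sum-const m 1) (*-identityʳ m)))

∣∣≡# : (A : Subset m) → ∣ A ∣ ≡ # (lookup A)
∣∣≡# []          = refl
∣∣≡# (true  ∷ A) = cong suc (∣∣≡# A)
∣∣≡# (false ∷ A) = ∣∣≡# A

∣tabulate∣≡# : (P : Fin m → Bool) → ∣ tabulate P ∣ ≡ # P
∣tabulate∣≡# P = trans (∣∣≡# (tabulate P)) (#-cong (lookup∘tabulate P))

∨-true : ∀ x y → x ∨ y ≡ true → x ≡ true ⊎ y ≡ true
∨-true true  y eq = inj₁ refl
∨-true false y eq = inj₂ eq

∧-false⇒∖ : ∀ x y → x ∧ y ≡ false → x ≡ x ∧ not y
∧-false⇒∖ true  false eq = refl
∧-false⇒∖ false y     eq = refl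

∖-false⇒∧ : ∀ x y → x ∧ not y ≡ false → x ≡ x ∧ y
∖-false⇒∧ true  true eq = refl
∖-false⇒∧ false y    eq = refl

true≢false : ∀ {x} → x ≡ true → x ≡ false → ⊥
true≢false refl ()

anyFin-intro : (f : Fin m → Bool) (i : Fin m) → f i ≡ true → anyFin f ≡ true
anyFin-intro f zero    eq rewrite eq = refl
anyFin-intro f (suc i) eq = trans (cong (f zero ∨_) (anyFin-intro (f ∘ suc) i eq)) (∨-zeroʳ (f zero))

anyFin-elim : (f : Fin m → Bool) → anyFin f ≡ true → ∃ λ i → f i ≡ true
anyFin-elim {suc m} f eq with ∨-true (f zero) _ eq
... | inj₁ eq₀ = zero , eq₀
... | inj₂ eq₁ with anyFin-elim (f ∘ suc) eq₁
...   | i , eqᵢ = suc i , eqᵢ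

anyFin-cong : {f g : Fin m → Bool} → f ≗ g → anyFin f ≡ anyFin g
anyFin-cong {zero}  f≗g = refl
anyFin-cong {suc m} f≗g = cong₂ _∨_ (f≗g zero) (anyFin-cong (f≗g ∘ suc))

-- Independent sets in a single graph

Indep : (K : Graph) → (Fin (n K) → Bool) → Set
Indep K A = ∀ u v → A u ≡ true → A v ≡ true → adj K u v ≢ true

nbhd : (K : Graph) → (Fin (n K) → Bool) → Fin (n K) → Bool
nbhd K A v = A v ∨ anyFin (λ u → A u ∧ adj K u v)

record Alpha (K : Graph) (a : ℕ) : Set where
  field
    I       : Fin (n K) → Bool
    I-indep : Indep K I
    #I      : # I ≡ a
    #≤a     : ∀ B → Indep K B → # B ≤ a

module _ (K : Graph) where

  Independent⇒Indep : (A : Subset (n K)) → Independent K A → Indep K (lookup A)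
  Independent⇒Indep A ind u v u∈A v∈A adj-uv =
    true≢false adj-uv (ind u v (lookup⇒[]= u A u∈A) (lookup⇒[]= v A v∈A))

  Indep⇒Independent : (P : Fin (n K) → Bool) → Indep K P → Independent K (tabulate P)
  Indep⇒Independent P ind u v u∈P v∈P =
    ¬-not (ind u v (trans (≡-sym (lookup∘tabulate P u)) ([]=⇒lookup u∈P))
                   (trans (≡-sym (lookup∘tabulate P v)) ([]=⇒lookup v∈P)))

  IsAlpha⇒Alpha : ∀ {a} → IsAlpha K a → Alpha K a
  IsAlpha⇒Alpha (A , (A-ind , A-max) , refl) = record
    { I       = lookup A
    ; I-indep = Independent⇒Indep A A-ind
    ; #I      = ≡-sym (∣∣≡# A)
    ; #≤a     = λ B B-ind → subst (_≤ ∣ A ∣) (∣tabulate∣≡# B)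
                  (A-max (tabulate B) (Indep⇒Independent B B-ind))
    }

  ∣closedNbhd∣≡# : (P : Fin (n K) → Bool) → ∣ closedNbhd K (tabulate P) ∣ ≡ # (nbhd K P)
  ∣closedNbhd∣≡# P = trans (∣tabulate∣≡# (nbhd K (lookup (tabulate P)))) (#-cong λ v →
    cong₂ _∨_ (lookup∘tabulate P v)
      (anyFin-cong λ u → cong (_∧ adj K u v) (lookup∘tabulate P u)))

  adj-sym : ∀ {u v} → adj K u v ≡ true → adj K v u ≡ true
  adj-sym {u} {v} = trans (sym K v u)

  nbhd-self : ∀ {A v} → A v ≡ true → nbhd K A v ≡ true
  nbhd-self v∈A rewrite v∈A = refl

  nbhd-adj : ∀ {A} u v → A u ≡ true → adj K u v ≡ true → nbhd K A v ≡ true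
  nbhd-adj {A} u v u∈A adj-uv =
    trans (cong (A v ∨_) (anyFin-intro _ u (cong₂ _∧_ u∈A adj-uv))) (∨-zeroʳ (A v))

  nbhd-elim : ∀ A v → nbhd K A v ≡ true → A v ≡ true ⊎ ∃ λ u → A u ≡ true × adj K u v ≡ true
  nbhd-elim A v eq with ∨-true (A v) _ eq
  ... | inj₁ v∈A = inj₁ v∈A
  ... | inj₂ eq′ with anyFin-elim _ eq′
  ...   | u , eqᵤ = inj₂ (u , ∧-conicalˡ _ _ eqᵤ , ∧-conicalʳ (A u) _ eqᵤ)

  module _ {a : ℕ} (α : Alpha K a) where

    open Alpha α

    -- (J ∖ N[A]) ∪ A is independent, so it is no larger than J.
    exchange : ∀ A J → Indep K A → Indep K J → # J ≡ a → # A ≤ # (J ∩ nbhd K A)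
    exchange A J A-ind J-ind #J =
      +-cancelʳ-≤ (# (J ∖ N)) (# A) (# (J ∩ N)) (begin
        # A + # (J ∖ N)        ≡⟨ ∑-distrib-+ (ι ∘ A) (ι ∘ (J ∖ N)) ⟨
        sum (λ v → ι (A v) + ι ((J ∖ N) v)) ≡⟨ sum-cong-≗ (λ v → count (A v) (J v) (N v) (nbhd-self {A} {v})) ⟨
        # B                    ≤⟨ #≤a B B-ind ⟩
        a                      ≡⟨ #J ⟨
        # J                    ≡⟨ #-split J N ⟩
        # (J ∩ N) + # (J ∖ N)  ∎)
      where
      open ≤-Reasoning
      N = nbhd K A
      B = A ∪ (J ∖ N)

      count : ∀ x j y → (x ≡ true → y ≡ true) → ι (x ∨ (j ∧ not y)) ≡ ι x + ι (j ∧ not y)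
      count true  true  true  x⇒y = refl
      count true  false true  x⇒y = refl
      count true  j     false x⇒y with () ← x⇒y refl
      count false j     y     x⇒y = refl

      apart : ∀ u v → A u ≡ true → (J ∖ N) v ≡ true → adj K u v ≢ true
      apart u v u∈A v∈J∖N adj-uv
        with N v | nbhd-adj {A} u v u∈A adj-uv | ∧-conicalʳ (J v) _ v∈J∖N
      ... | true | _ | ()

      B-ind : Indep K B
      B-ind u v u∈B v∈B adj-uv with ∨-true (A u) _ u∈B | ∨-true (A v) _ v∈B
      ... | inj₁ u∈A | inj₁ v∈A = A-ind u v u∈A v∈A adj-uv
      ... | inj₁ u∈A | inj₂ v∈J = apart u v u∈A v∈J adj-uv
      ... | inj₂ u∈J | inj₁ v∈A = apart v u v∈A u∈J (adj-sym adj-uv)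
      ... | inj₂ u∈J | inj₂ v∈J = J-ind u v (∧-conicalˡ _ _ u∈J) (∧-conicalˡ _ _ v∈J) adj-uv

x*[y*z]≡y*[x*z] : ∀ x y z → x * (y * z) ≡ y * (x * z)
x*[y*z]≡y*[x*z] = solve-∀

[x*y]*z≡[x*z]*y : ∀ x y z → x * y * z ≡ x * z * y
[x*y]*z≡[x*z]*y = solve-∀

-- Numbering of the subsets of a finite set

funToFin-cong : {f g : Fin m → Fin k} → f ≗ g → funToFin f ≡ funToFin g
funToFin-cong {zero}  f≗g = refl
funToFin-cong {suc m} f≗g = cong₂ combine (f≗g zero) (funToFin-cong (f≗g ∘ suc))

-- Subsets are numbered so that a sum over all of them is again a `sum` over some `Fin`, and a
-- permutation of vertices induces one of indices.
decode : Fin (2 ^ m) → Fin m → Bool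
decode k i = Inverse.to 2↔Bool (finToFun k i)

encode : (Fin m → Bool) → Fin (2 ^ m)
encode P = funToFin (Inverse.from 2↔Bool ∘ P)

decode-encode : (P : Fin m → Bool) → decode (encode P) ≗ P
decode-encode P i =
  trans (cong (Inverse.to 2↔Bool) (finToFun-funToFin (Inverse.from 2↔Bool ∘ P) i))
    (Inverse.strictlyInverseˡ 2↔Bool (P i))

encode-cong : {P Q : Fin m → Bool} → P ≗ Q → encode P ≡ encode Q
encode-cong P≗Q = funToFin-cong (cong (Inverse.from 2↔Bool) ∘ P≗Q)

encode-decode : (x : Fin (2 ^ m)) → encode {m} (decode x) ≡ x
encode-decode {m} x =
  trans (funToFin-cong (λ i → Inverse.strictlyInverseʳ 2↔Bool (finToFun {2} {m} x i)))
    (funToFin-finToFin {m} x)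

-- The action of `σ` on subsets, in the form of a permutation of codes so that `sum-permute` applies
-- to it.
preimage : Permutation′ m → Permutation′ (2 ^ m)
preimage {m} σ = permutation
  (λ x → encode (decode x ∘ (σ ⟨$⟩ʳ_)))
  (λ x → encode (decode x ∘ (σ ⟨$⟩ˡ_)))
  (λ x → trans (encode-cong λ i → trans (decode-encode (decode x ∘ (σ ⟨$⟩ˡ_)) (σ ⟨$⟩ʳ i))
                                    (cong (decode x) (inverseˡ σ)))
               (encode-decode {m} x))
  (λ x → trans (encode-cong λ i → trans (decode-encode (decode x ∘ (σ ⟨$⟩ʳ_)) (σ ⟨$⟩ˡ i))
                                    (cong (decode x) (inverseʳ σ)))
               (encode-decode {m} x))

-- Averaging over the maximum independent sets of a vertex-transitive graph

module _ (K : Graph) where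

  IsAutomorphism-flip : ∀ σ → IsAutomorphism K σ → IsAutomorphism K (flip σ)
  IsAutomorphism-flip σ σ-aut u v =
    trans (≡-sym (σ-aut (σ ⟨$⟩ˡ u) (σ ⟨$⟩ˡ v))) (cong₂ (adj K) (inverseʳ σ) (inverseʳ σ))

  MaxIndep : ℕ → (Fin (n K) → Bool) → Set
  MaxIndep a P = Indep K P × # P ≡ a

  maxIndep? : ∀ a P → Dec (MaxIndep a P)
  maxIndep? a P =
    all? (λ u → all? λ v → (P u ≟ᵇ true) →-dec (P v ≟ᵇ true) →-dec ¬? (adj K u v ≟ᵇ true))
      ×-dec (# P ≟ a)

  -- Asking only for pointwise agreement of `Q` suits decoded preimages, which are known only
  -- pointwise.
  MaxIndep-pullback : ∀ {a P Q} σ → IsAutomorphism K σ → Q ≗ P ∘ (σ ⟨$⟩ʳ_) →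
                      MaxIndep a P → MaxIndep a Q
  MaxIndep-pullback {P = P} σ σ-aut Q≗Pσ (P-ind , #P) =
    (λ u v u∈Q v∈Q adj-uv → P-ind (σ ⟨$⟩ʳ u) (σ ⟨$⟩ʳ v)
      (trans (≡-sym (Q≗Pσ u)) u∈Q) (trans (≡-sym (Q≗Pσ v)) v∈Q) (trans (σ-aut u v) adj-uv)) ,
    trans (#-cong Q≗Pσ) (trans (≡-sym (sum-permute (ι ∘ P) σ)) #P)

  module _ (vt : VertexTransitive K) {a : ℕ} (α : Alpha K a) (v₀ : Fin (n K)) where

    open Alpha α
    open ≡-Reasoning

    set : Fin (2 ^ n K) → Fin (n K) → Bool
    set = decode

    -- Indicator of the codes of maximum independent sets; accordingly `total` counts these sets and
    -- `degree v` those containing `v`.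
    weight : Fin (2 ^ n K) → ℕ
    weight x = ι (does (maxIndep? a (set x)))

    total : ℕ
    total = sum weight

    degree : Fin (n K) → ℕ
    degree v = sum (λ x → weight x * ι (set x v))

    weight-preimage : ∀ σ → IsAutomorphism K σ → ∀ x → weight (preimage σ ⟨$⟩ʳ x) ≡ weight x
    weight-preimage σ σ-aut x = cong ι (does-⇔ (mk⇔
      -- `set x` is recovered from its preimage by pulling back along the inverse automorphism.
      (MaxIndep-pullback (flip σ) (IsAutomorphism-flip σ σ-aut)
        λ v → trans (cong (set x) (≡-sym (inverseʳ σ))) (≡-sym (eq (σ ⟨$⟩ˡ v))))
      (MaxIndep-pullback σ σ-aut eq)) (maxIndep? a _) (maxIndep? a _))
      where
      eq : set (preimage σ ⟨$⟩ʳ x) ≗ set x ∘ (σ ⟨$⟩ʳ_)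
      eq = decode-encode (set x ∘ (σ ⟨$⟩ʳ_))

    -- Reindexing the sum by `preimage σ` keeps the weights, and `v` lies in the preimage of a set
    -- exactly when `σ ⟨$⟩ʳ v` lies in the set.
    degree-automorphism : ∀ σ → IsAutomorphism K σ → ∀ v → degree v ≡ degree (σ ⟨$⟩ʳ v)
    degree-automorphism σ σ-aut v =
      trans (sum-permute (λ x → weight x * ι (set x v)) (preimage σ))
        (sum-cong-≗ λ x → cong₂ _*_ (weight-preimage σ σ-aut x)
          (cong ι (decode-encode (set x ∘ (σ ⟨$⟩ʳ_)) v)))

    degree-const : ∀ v → degree v ≡ degree v₀
    degree-const v with vt v v₀
    ... | σ , σ-aut , refl = degree-automorphism σ σ-aut v

    weight-max : ∀ x → weight x * # (set x) ≡ weight x * a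
    weight-max x = ≤-antisym (does*-mono (maxIndep? a (set x)) (≤-reflexive ∘ proj₂))
                             (does*-mono (maxIndep? a (set x)) (≤-reflexive ∘ ≡-sym ∘ proj₂))

    -- Double counting of the pairs of a vertex and a maximum independent set containing it.
    size*degree : n K * degree v₀ ≡ total * a
    size*degree = begin
      n K * degree v₀                                  ≡⟨ sum-const (n K) (degree v₀) ⟨
      sum {n K} (λ _ → degree v₀)                      ≡⟨ sum-cong-≗ degree-const ⟨
      sum degree                                       ≡⟨ ∑-comm (λ v x → weight x * ι (set x v)) ⟩
      sum (λ x → sum (λ v → weight x * ι (set x v))) ≡⟨ sum-cong-≗ (λ x → *-distribˡ-sum (weight x) (ι ∘ set x)) ⟨
      sum (λ x → weight x * # (set x))              ≡⟨ sum-cong-≗ weight-max ⟩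
      sum (λ x → weight x * a)                         ≡⟨ *-distribʳ-sum a weight ⟨
      total * a                                        ∎

    -- The set supplied by `Alpha` has weight 1. Positivity permits cancelling `total` in `ratio`.
    0<total : 0 < total
    0<total = ≤-trans (≤-reflexive (≡-sym (cong ι (dec-true (maxIndep? a _) I-max))))
                (term≤sum weight (encode I))
      where
      I-max : MaxIndep a (set (encode I))
      I-max = (λ u v u∈ v∈ → I-indep u v (trans (≡-sym (decode-encode I u)) u∈)
                                         (trans (≡-sym (decode-encode I v)) v∈)) ,
              trans (#-cong (decode-encode I)) #I

    -- Sum `exchange` over the maximum independent sets, then count their incidences with N[A]
    -- vertex by vertex; each vertex contributes `degree v₀`.
    total*#≤ : ∀ A → Indep K A → total * # A ≤ # (nbhd K A) * degree v₀
    total*#≤ A A-ind = ≤-trans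
      (≤-trans (≤-reflexive (*-distribʳ-sum (# A) weight)) (sum-mono-≤ weighted-exchange))
      (≤-reflexive count)
      where
      N = nbhd K A

      weighted-exchange : ∀ x → weight x * # A ≤ weight x * # (set x ∩ N)
      weighted-exchange x = does*-mono (maxIndep? a (set x))
        λ (x-ind , #x) → exchange K α A (set x) A-ind x-ind #x

      rearrange : ∀ x v → weight x * ι ((set x ∩ N) v) ≡ ι (N v) * (weight x * ι (set x v))
      rearrange x v =
        trans (cong (weight x *_) (ι-∧ (set x v) (N v)))
          (trans (≡-sym (*-assoc (weight x) _ _)) (*-comm _ (ι (N v))))

      count : sum (λ x → weight x * # (set x ∩ N)) ≡ # N * degree v₀
      count = begin
        sum (λ x → weight x * # (set x ∩ N))
          ≡⟨ sum-cong-≗ (λ x → *-distribˡ-sum (weight x) (ι ∘ (set x ∩ N))) ⟩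
        sum (λ x → sum (λ v → weight x * ι ((set x ∩ N) v)))
          ≡⟨ ∑-comm (λ x v → weight x * ι ((set x ∩ N) v)) ⟩
        sum (λ v → sum (λ x → weight x * ι ((set x ∩ N) v)))
          ≡⟨ sum-cong-≗ (λ v → sum-cong-≗ (λ x → rearrange x v)) ⟩
        sum (λ v → sum (λ x → ι (N v) * (weight x * ι (set x v))))
          ≡⟨ sum-cong-≗ (λ v → *-distribˡ-sum (ι (N v)) (λ x → weight x * ι (set x v))) ⟨
        sum (λ v → ι (N v) * degree v)
          ≡⟨ sum-cong-≗ (λ v → cong (ι (N v) *_) (degree-const v)) ⟩
        sum (λ v → ι (N v) * degree v₀)
          ≡⟨ *-distribʳ-sum (degree v₀) (ι ∘ N) ⟨
        # N * degree v₀ ∎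

    -- Average the exchange inequality over all maximum independent sets: by
    -- transitivity each vertex lies in the same number (degree) of them.
    ratio : ∀ A → Indep K A → # A * n K ≤ a * # (nbhd K A)
    ratio A A-ind = *-cancelˡ-≤ total {{>-nonZero 0<total}} (R.begin
      total * (# A * n K)     R.≡⟨ cong (total *_) (*-comm (# A) (n K)) ⟩
      total * (n K * # A)     R.≡⟨ x*[y*z]≡y*[x*z] total (n K) (# A) ⟩
      n K * (total * # A)     R.≤⟨ *-monoʳ-≤ (n K) (total*#≤ A A-ind) ⟩
      n K * (#N * degree v₀)  R.≡⟨ x*[y*z]≡y*[x*z] (n K) #N (degree v₀) ⟩
      #N * (n K * degree v₀)  R.≡⟨ cong (#N *_) size*degree ⟩
      #N * (total * a)        R.≡⟨ x*[y*z]≡y*[x*z] #N total a ⟩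
      total * (#N * a)        R.≡⟨ cong (total *_) (*-comm #N a) ⟩
      total * (a * #N)        R.∎)
      where
      module R = ≤-Reasoning
      #N = # (nbhd K A)

-- Separations

-- `C` is a nonempty proper union of components. Such a witness yields disconnectedness and can also
-- be intersected with a maximum independent set.
Separated : Graph → Set
Separated K = Σ (Fin (n K) → Bool) λ C → (∀ u v → C u ≡ true → adj K u v ≡ true → C v ≡ true)
  × (∃ λ u → C u ≡ true) × (∃ λ v → C v ≡ false)

does⁻ : {P : Set} (P? : Dec P) → does P? ≡ true → P
does⁻ (yes p) _ = p

∀Fin-⊎ : {P : Fin m → Set} {Q : Set} → (∀ i → P i ⊎ Q) → (∀ i → P i) ⊎ Q
∀Fin-⊎ {zero}  f = inj₁ λ ()
∀Fin-⊎ {suc m} f with f zero | ∀Fin-⊎ (f ∘ suc)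
... | inj₂ q | _       = inj₂ q
... | inj₁ _ | inj₂ q  = inj₂ q
... | inj₁ p | inj₁ ps = inj₁ λ where
  zero    → p
  (suc i) → ps i

-- An exhaustive search, which pulls an alternative independent of `S` out of the quantifier over
-- all `S` in `MISNormal`.
∀Subset-⊎ : {P : Subset m → Set} {Q : Set} → (∀ S → P S ⊎ Q) → (∀ S → P S) ⊎ Q
∀Subset-⊎ {zero} f with f []
... | inj₁ p = inj₁ λ where [] → p
... | inj₂ q = inj₂ q
∀Subset-⊎ {suc m} f with ∀Subset-⊎ (f ∘ (true ∷_)) | ∀Subset-⊎ (f ∘ (false ∷_))
... | inj₂ q  | _        = inj₂ q
... | inj₁ _  | inj₂ q   = inj₂ q
... | inj₁ ps | inj₁ ps′ = inj₁ λ where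
  (true  ∷ S) → ps S
  (false ∷ S) → ps′ S

module _ (K : Graph) where

  separated⇒disconnected : Separated K → Disconnected K
  separated⇒disconnected (C , closed , (u , u∈C) , (v , v∉C)) connected =
    true≢false (walk (connected u v) u∈C) v∉C
    where
    walk : ∀ {x y} → Walk K x y → C x ≡ true → C y ≡ true
    walk here         x∈C = x∈C
    walk (step adj w) x∈C = walk w (closed _ _ x∈C adj)

  -- The separating set consists of the vertices where `F` agrees with `F v₀`; edges preserve it,
  -- and a vertex refuting constancy lies outside.
  constant-or-separated : (F : Fin (n K) → Fin m → Bool) →
                          (∀ u v → adj K u v ≡ true → F u ≗ F v) →
                          ∀ v₀ → (∀ v → F v ≗ F v₀) ⊎ Separated K
  constant-or-separated F F-adj v₀ = case (all? agrees?)
    where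
    agrees? : ∀ v → Dec (F v ≗ F v₀)
    agrees? v = all? (λ i → F v i ≟ᵇ F v₀ i)

    case : Dec (∀ v → F v ≗ F v₀) → (∀ v → F v ≗ F v₀) ⊎ Separated K
    case (yes const) = inj₁ const
    case (no ¬const) with ¬∀⟶∃¬ _ _ agrees? ¬const
    ... | v , v≢ = inj₂
      ( does ∘ agrees?
      , (λ u w u∈C adj-uw → dec-true (agrees? w) λ i →
          trans (≡-sym (F-adj u w adj-uw i)) (does⁻ (agrees? u) u∈C i))
      , (v₀ , dec-true (agrees? v₀) (λ _ → refl))
      , (v , dec-false (agrees? v) v≢) )

  module _ {a : ℕ} (α : Alpha K a) where

    open Alpha α

    -- With no edges between `P` and `Q`, their union is independent and has at most `a` elements,
    -- so it equals each of them.
    maximum-agree : ∀ P Q → Indep K P → Indep K Q → # P ≡ a → # Q ≡ a →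
                    (∀ u v → P u ≡ true → Q v ≡ true → adj K u v ≢ true) → P ≗ Q
    maximum-agree P Q P-ind Q-ind #P #Q apart i = trans (P≗U i) (≡-sym (Q≗U i))
      where
      U-ind : Indep K (P ∪ Q)
      U-ind u v u∈U v∈U adj-uv with ∨-true (P u) _ u∈U | ∨-true (P v) _ v∈U
      ... | inj₁ u∈P | inj₁ v∈P = P-ind u v u∈P v∈P adj-uv
      ... | inj₁ u∈P | inj₂ v∈Q = apart u v u∈P v∈Q adj-uv
      ... | inj₂ u∈Q | inj₁ v∈P = apart v u v∈P u∈Q (adj-sym K adj-uv)
      ... | inj₂ u∈Q | inj₂ v∈Q = Q-ind u v u∈Q v∈Q adj-uv

      P≗U : P ≗ (P ∪ Q)
      P≗U = #-tight (λ j j∈P → cong (_∨ Q j) j∈P)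
              (≤-trans (#≤a _ U-ind) (≤-reflexive (≡-sym #P)))

      Q≗U : Q ≗ (P ∪ Q)
      Q≗U = #-tight (λ j j∈Q → trans (cong (P j ∨_) j∈Q) (∨-zeroʳ (P j)))
              (≤-trans (#≤a _ U-ind) (≤-reflexive (≡-sym #Q)))

    0<α : Fin (n K) → 0 < a
    0<α v₀ = ≤-trans (∈⇒0<# {P = P} {v₀} (dec-true (v₀ ≟ᶠ v₀) refl)) (#≤a P P-ind)
      where
      P : Fin (n K) → Bool
      P v = does (v ≟ᶠ v₀)

      P-ind : Indep K P
      P-ind u v u∈P v∈P adj-uv with does⁻ (u ≟ᶠ v₀) u∈P | does⁻ (v ≟ᶠ v₀) v∈P
      ... | refl | refl = true≢false adj-uv (irrefl K u)

  module _ {a : ℕ} (isα : IsAlpha K a) where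

    private α = IsAlpha⇒Alpha K isα

    open Alpha α

    imprimitive-intro : ∀ A → Indep K A → 0 < # A → # A < a →
                        # A * n K ≡ a * # (nbhd K A) → ISImprimitive K
    imprimitive-intro A A-ind 0<#A #A<a tight with 0<#⇒∈ A 0<#A
    ... | v , v∈A =
      a , isα , tabulate A , Indep⇒Independent K A A-ind ,
      (v , lookup⇒[]= v _ (trans (lookup∘tabulate A v) v∈A)) ,
      subst (_< a) (≡-sym (∣tabulate∣≡# A)) #A<a ,
      trans (cong (_* n K) (∣tabulate∣≡# A)) (trans tight (cong (a *_) (≡-sym (∣closedNbhd∣≡# K A))))

    -- A set that attains the ratio with size strictly between 0 and `a` is itself an imprimitive
    -- set.
    trivial-or-imprimitive : (F : Fin m → Fin (n K) → Bool) → (∀ i → Indep K (F i)) →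
                             (∀ i → # (F i) * n K ≡ a * # (nbhd K (F i))) →
                             (∀ i → # (F i) ≡ 0 ⊎ # (F i) ≡ a) ⊎ ISImprimitive K
    trivial-or-imprimitive F F-ind tight = ∀Fin-⊎ cases
      where
      cases : ∀ i → (# (F i) ≡ 0 ⊎ # (F i) ≡ a) ⊎ ISImprimitive K
      cases i with # (F i) ≟ 0 | # (F i) ≟ a
      ... | yes eq | _      = inj₁ (inj₁ eq)
      ... | no _   | yes eq = inj₁ (inj₂ eq)
      ... | no ≢0  | no ≢a  = inj₂ (imprimitive-intro (F i) (F-ind i) (n≢0⇒n>0 ≢0)
                                     (≤∧≢⇒< (#≤a _ (F-ind i)) ≢a) (tight i))

    -- The part of a maximum independent set on one side of a separation is imprimitive.
    separated⇒imprimitive : VertexTransitive K → Separated K → ISImprimitive K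
    separated⇒imprimitive vt (C , closed , (u , u∈C) , (v , v∉C)) =
      imprimitive-intro A A-ind (0<part A C (proj₁ tight) (∈⇒0<# {P = C} u∈C))
        (subst (# A <_) #A+#A′ (m<m+n (# A) (0<part A′ C′ (proj₂ tight) (∈⇒0<# {P = C′} (cong not v∉C)))))
        (≤-antisym (ratio K vt α u A A-ind)
          (≤-trans (*-monoʳ-≤ a (#-mono NA⊆C)) (≤-reflexive (≡-sym (proj₁ tight)))))
      where
      A A′ C′ : Fin (n K) → Bool
      C′ = not ∘ C
      A  = I ∩ C
      A′ = I ∖ C

      A-ind : Indep K A
      A-ind x y x∈ y∈ = I-indep x y (∧-conicalˡ _ _ x∈) (∧-conicalˡ _ _ y∈)

      A′-ind : Indep K A′
      A′-ind x y x∈ y∈ = I-indep x y (∧-conicalˡ _ _ x∈) (∧-conicalˡ _ _ y∈)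

      NA⊆C : ∀ x → nbhd K A x ≡ true → C x ≡ true
      NA⊆C x x∈N with nbhd-elim K A x x∈N
      ... | inj₁ x∈A                = ∧-conicalʳ (I x) _ x∈A
      ... | inj₂ (y , y∈A , adj-yx) = closed y x (∧-conicalʳ (I y) _ y∈A) adj-yx

      NA′⊆C′ : ∀ x → nbhd K A′ x ≡ true → not (C x) ≡ true
      NA′⊆C′ x x∈N with nbhd-elim K A′ x x∈N
      ... | inj₁ x∈A′                = ∧-conicalʳ (I x) _ x∈A′
      ... | inj₂ (y , y∈A′ , adj-yx) with C x in eq
      ...   | false = refl
      ...   | true with C y | closed x y eq (adj-sym K adj-yx) | ∧-conicalʳ (I y) _ y∈A′
      ...     | true | _ | ()

      #A+#A′ : # A + # A′ ≡ a
      #A+#A′ = trans (≡-sym (#-split I C)) #I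

      -- Closed neighbourhoods of the two parts stay on their own sides, and the two bounds add up
      -- to an equality, so each is attained.
      tight : # A * n K ≡ a * # C × # A′ * n K ≡ a * # C′
      tight = +-tight
        (≤-trans (ratio K vt α u A A-ind) (*-monoʳ-≤ a (#-mono NA⊆C)))
        (≤-trans (ratio K vt α u A′ A′-ind) (*-monoʳ-≤ a (#-mono NA′⊆C′)))
        (≤-reflexive (begin
          a * # C + a * # C′  ≡⟨ *-distribˡ-+ a (# C) (# C′) ⟨
          a * (# C + # C′)    ≡⟨ cong (a *_) (#-complement C) ⟩
          a * n K                    ≡⟨ cong (_* n K) #A+#A′ ⟨
          (# A + # A′) * n K         ≡⟨ *-distribʳ-+ (n K) (# A) (# A′) ⟩
          # A * n K + # A′ * n K     ∎))
        where open ≡-Reasoning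

      -- An empty part would make `a * # X` vanish although both factors are positive. Used on both
      -- sides, this makes `A` nonempty and smaller than `a`.
      0<part : ∀ (B X : Fin (n K) → Bool) → # B * n K ≡ a * # X → 0 < # X → 0 < # B
      0<part B X eq 0<#X = n≢0⇒n>0 λ #B≡0 →
        <⇒≢ (*-mono-< (0<α α u) 0<#X) (trans (≡-sym (cong (_* n K) #B≡0)) eq)

-- Independent sets in the direct product

CylinderOverG CylinderOverH : (G H : Graph) → (Fin (n G) → Fin (n H) → Bool) → Set
CylinderOverG G H S = Σ (Fin (n G) → Bool) λ I → Indep G I × (∀ g h → S g h ≡ I g)
CylinderOverH G H S = Σ (Fin (n H) → Bool) λ J → Indep H J × (∀ g h → S g h ≡ J h)

-- Isolated and crowded vertices of the fibres

module Decomposition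
  (G H : Graph) (S : Fin (n G) → Fin (n H) → Bool)
  (S-ind : ∀ g h g′ h′ → S g h ≡ true → S g′ h′ ≡ true → adj G g g′ ≡ true → adj H h h′ ≢ true)
  where

  -- Tested for every `g`, in the fibre over `h` or not; `A` and `D` split the fibre by it. Their
  -- indexing is opposite: `A h` is a set in `G`, `D g` a set in `H`.
  crowded : Fin (n H) → Fin (n G) → Bool
  crowded h g = anyFin (λ g′ → S g′ h ∧ adj G g′ g)

  A : Fin (n H) → Fin (n G) → Bool
  A h g = S g h ∧ not (crowded h g)

  D : Fin (n G) → Fin (n H) → Bool
  D g h = S g h ∧ crowded h g

  NA : Fin (n H) → Fin (n G) → Bool
  NA h = nbhd G (A h)

  ND : Fin (n G) → Fin (n H) → Bool
  ND g = nbhd H (D g)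

  A⇒S : ∀ h g → A h g ≡ true → S g h ≡ true
  A⇒S h g = ∧-conicalˡ _ _

  D⇒S : ∀ g h → D g h ≡ true → S g h ≡ true
  D⇒S g h = ∧-conicalˡ _ _

  A-isolated : ∀ h g g′ → A h g ≡ true → S g′ h ≡ true → adj G g′ g ≢ true
  A-isolated h g g′ g∈A g′∈S adj-g
    with crowded h g | anyFin-intro (λ x → S x h ∧ adj G x g) g′ (cong₂ _∧_ g′∈S adj-g)
       | ∧-conicalʳ (S g h) _ g∈A
  ... | true | _ | ()

  D-crowded : ∀ g h → D g h ≡ true → ∃ λ g′ → S g′ h ≡ true × adj G g′ g ≡ true
  D-crowded g h h∈D with anyFin-elim _ (∧-conicalʳ (S g h) _ h∈D)
  ... | g′ , eq = g′ , ∧-conicalˡ _ _ eq , ∧-conicalʳ (S g′ h) _ eq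

  -- The neighbour `g′` of `g` in the fibre over `h` puts `(g′ , h)` and `(g , h′)` in conflict.
  -- Comparison with all of `S g` is what disjointness needs.
  D-apart : ∀ g h h′ → D g h ≡ true → S g h′ ≡ true → adj H h h′ ≢ true
  D-apart g h h′ h∈D h′∈S with D-crowded g h h∈D
  ... | g′ , g′∈S , adj-g = S-ind g′ h g h′ g′∈S h′∈S adj-g

  A-ind : ∀ h → Indep G (A h)
  A-ind h u v u∈A v∈A = A-isolated h v u v∈A (A⇒S h u u∈A)

  D-ind : ∀ g → Indep H (D g)
  D-ind g u v u∈D v∈D = D-apart g u v u∈D (D⇒S g v v∈D)

  -- If `h` is in `D g`, isolation in `A h` fails; if only `g` is in `A h`, `D-apart` fails;
  -- otherwise `(u , h)` and `(g , w)` would be adjacent members of `S`.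
  NA-ND-disjoint : ∀ g h → NA h g ≡ true → ND g h ≢ true
  NA-ND-disjoint g h g∈NA h∈ND with nbhd-elim G (A h) g g∈NA | nbhd-elim H (D g) h h∈ND
  ... | inj₁ g∈A | inj₁ h∈D with D-crowded g h h∈D
  ...   | g′ , g′∈S , adj-g = A-isolated h g g′ g∈A g′∈S adj-g
  NA-ND-disjoint g h _ _ | inj₂ (u , u∈A , adj-ug) | inj₁ h∈D =
    A-isolated h u g u∈A (D⇒S g h h∈D) (adj-sym G adj-ug)
  NA-ND-disjoint g h _ _ | inj₁ g∈A | inj₂ (w , w∈D , adj-wh) =
    D-apart g w h w∈D (A⇒S h g g∈A) adj-wh
  NA-ND-disjoint g h _ _ | inj₂ (u , u∈A , adj-ug) | inj₂ (w , w∈D , adj-wh) =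
    S-ind u h g w (A⇒S h u u∈A) (D⇒S g w w∈D) adj-ug (adj-sym H adj-wh)

  #S ΣA ΣD ΣNA ΣND : ℕ
  #S  = sum (λ g → # (S g))
  ΣA  = sum (λ h → # (A h))
  ΣD  = sum (λ g → # (D g))
  ΣNA = sum (λ h → # (NA h))
  ΣND = sum (λ g → # (ND g))

  sum₂-+ : (P : Fin (n H) → Fin (n G) → Bool) (Q : Fin (n G) → Fin (n H) → Bool) →
           sum (λ g → sum (λ h → ι (P h g) + ι (Q g h))) ≡ sum (λ h → # (P h)) + sum (λ g → # (Q g))
  sum₂-+ P Q = begin
    sum (λ g → sum (λ h → ι (P h g) + ι (Q g h)))
      ≡⟨ sum-cong-≗ (λ g → ∑-distrib-+ (λ h → ι (P h g)) (ι ∘ Q g)) ⟩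
    sum (λ g → sum (λ h → ι (P h g)) + # (Q g))
      ≡⟨ ∑-distrib-+ (λ g → sum (λ h → ι (P h g))) (λ g → # (Q g)) ⟩
    sum (λ g → sum (λ h → ι (P h g))) + sum (λ g → # (Q g))
      ≡⟨ cong (_+ sum (λ g → # (Q g))) (∑-comm (λ g h → ι (P h g))) ⟩
    sum (λ h → # (P h)) + sum (λ g → # (Q g)) ∎
    where open ≡-Reasoning

  #S≡ΣA+ΣD : #S ≡ ΣA + ΣD
  #S≡ΣA+ΣD = trans
    (sum-cong-≗ λ g → sum-cong-≗ λ h →
      trans (ι-split (S g h) (crowded h g)) (+-comm (ι (D g h)) (ι (A h g))))
    (sum₂-+ A D)

  sum₂-1 : sum {n G} (λ _ → sum {n H} (λ _ → 1)) ≡ n G * n H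
  sum₂-1 = trans (sum-const (n G) _) (cong (n G *_) (trans (sum-const (n H) 1) (*-identityʳ (n H))))

  ι-NA-ND≤1 : ∀ g h → ι (NA h g) + ι (ND g h) ≤ 1
  ι-NA-ND≤1 g h = ι-disjoint (NA-ND-disjoint g h)

  ΣNA+ΣND≤ : ΣNA + ΣND ≤ n G * n H
  ΣNA+ΣND≤ = begin
    ΣNA + ΣND                                        ≡⟨ sum₂-+ NA ND ⟨
    sum (λ g → sum (λ h → ι (NA h g) + ι (ND g h)))  ≤⟨ sum-mono-≤ (λ g → sum-mono-≤ (ι-NA-ND≤1 g)) ⟩
    sum {n G} (λ _ → sum {n H} (λ _ → 1))            ≡⟨ sum₂-1 ⟩
    n G * n H                                        ∎
    where open ≤-Reasoning

  -- `sum-tight` is applied twice, first to the row totals and then within the row of `g`.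
  partition : n G * n H ≤ ΣNA + ΣND → ∀ g h → ι (NA h g) + ι (ND g h) ≡ 1
  partition le g = sum-tight (ι-NA-ND≤1 g)
    (≤-reflexive (≡-sym (sum-tight (λ g′ → sum-mono-≤ (ι-NA-ND≤1 g′))
      (≤-trans (≤-reflexive sum₂-1) (≤-trans le (≤-reflexive (≡-sym (sum₂-+ NA ND))))) g)))

  -- The upper bound and its equality case

  module Bound
    (g₀ : Fin (n G)) (h₀ : Fin (n H)) (vtG : VertexTransitive G) (vtH : VertexTransitive H)
    {a b : ℕ} (isαG : IsAlpha G a) (isαH : IsAlpha H b) (b≤a : b * n G ≤ a * n H)
    where

    private
      αG = IsAlpha⇒Alpha G isαG
      αH = IsAlpha⇒Alpha H isαH

    instance
      nG≢0 : NonZero (n G)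
      nG≢0 = nonZeroIndex g₀

      nH≢0 : NonZero (n H)
      nH≢0 = nonZeroIndex h₀

    A-ratio : ∀ h → # (A h) * n G ≤ a * # (NA h)
    A-ratio h = ratio G vtG αG g₀ (A h) (A-ind h)

    D-ratioᴴ : ∀ g → # (D g) * n H ≤ b * # (ND g)
    D-ratioᴴ g = ratio H vtH αH h₀ (D g) (D-ind g)

    -- The ratio of `H` is traded for that of `G` through `b≤a`, with `n H` multiplied in and
    -- cancelled at the end.
    D-ratio : ∀ g → # (D g) * n G ≤ a * # (ND g)
    D-ratio g = *-cancelʳ-≤ _ _ (n H) (begin
      # (D g) * n G * n H    ≡⟨ [x*y]*z≡[x*z]*y (# (D g)) (n G) (n H) ⟩
      # (D g) * n H * n G    ≤⟨ *-monoˡ-≤ (n G) (D-ratioᴴ g) ⟩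
      b * # (ND g) * n G     ≡⟨ [x*y]*z≡[x*z]*y b (# (ND g)) (n G) ⟩
      b * n G * # (ND g)     ≤⟨ *-monoˡ-≤ (# (ND g)) b≤a ⟩
      a * n H * # (ND g)     ≡⟨ [x*y]*z≡[x*z]*y a (n H) (# (ND g)) ⟩
      a * # (ND g) * n H     ∎)
      where open ≤-Reasoning

    lhs≡ : sum (λ h → # (A h) * n G) + sum (λ g → # (D g) * n G) ≡ #S * n G
    lhs≡ = begin
      sum (λ h → # (A h) * n G) + sum (λ g → # (D g) * n G)
        ≡⟨ cong₂ _+_ (*-distribʳ-sum (n G) (λ h → # (A h))) (*-distribʳ-sum (n G) (λ g → # (D g))) ⟨
      ΣA * n G + ΣD * n G
        ≡⟨ *-distribʳ-+ (n G) ΣA ΣD ⟨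
      (ΣA + ΣD) * n G
        ≡⟨ cong (_* n G) #S≡ΣA+ΣD ⟨
      #S * n G ∎
      where open ≡-Reasoning

    rhs≡ : sum (λ h → a * # (NA h)) + sum (λ g → a * # (ND g)) ≡ a * (ΣNA + ΣND)
    rhs≡ = trans
      (≡-sym (cong₂ _+_ (*-distribˡ-sum a (λ h → # (NA h))) (*-distribˡ-sum a (λ g → # (ND g)))))
      (≡-sym (*-distribˡ-+ a ΣNA ΣND))

    #S*nG≤ : #S * n G ≤ a * (ΣNA + ΣND)
    #S*nG≤ = subst₂ _≤_ lhs≡ rhs≡ (+-mono-≤ (sum-mono-≤ A-ratio) (sum-mono-≤ D-ratio))

    bound : #S ≤ a * n H
    bound = *-cancelʳ-≤ _ _ (n G) (begin
      #S * n G          ≤⟨ #S*nG≤ ⟩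
      a * (ΣNA + ΣND)   ≤⟨ *-monoʳ-≤ a ΣNA+ΣND≤ ⟩
      a * (n G * n H)   ≡⟨ cong (a *_) (*-comm (n G) (n H)) ⟩
      a * (n H * n G)   ≡⟨ *-assoc a (n H) (n G) ⟨
      a * n H * n G     ∎)
      where open ≤-Reasoning

    module Extremal (maximum : a * n H ≤ #S) where

      instance
        a≢0 : NonZero a
        a≢0 = >-nonZero (0<α G αG g₀)

      a*size≤ : a * (n G * n H) ≤ #S * n G
      a*size≤ = begin
        a * (n G * n H)  ≡⟨ cong (a *_) (*-comm (n G) (n H)) ⟩
        a * (n H * n G)  ≡⟨ *-assoc a (n H) (n G) ⟨
        a * n H * n G    ≤⟨ *-monoˡ-≤ (n G) maximum ⟩
        #S * n G         ∎
        where open ≤-Reasoning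

      NA+ND≡1 : ∀ g h → ι (NA h g) + ι (ND g h) ≡ 1
      NA+ND≡1 = partition (*-cancelˡ-≤ a (≤-trans a*size≤ #S*nG≤))

      -- The chain from `#S * n G` through `a * (ΣNA + ΣND)` and `a * (n G * n H)` back to
      -- `#S * n G` closes up, so both halves of its first step are equalities.
      sums-tight : sum (λ h → # (A h) * n G) ≡ sum (λ h → a * # (NA h))
                 × sum (λ g → # (D g) * n G) ≡ sum (λ g → a * # (ND g))
      sums-tight = +-tight (sum-mono-≤ A-ratio) (sum-mono-≤ D-ratio)
        (subst₂ _≤_ (≡-sym rhs≡) (≡-sym lhs≡) (≤-trans (*-monoʳ-≤ a ΣNA+ΣND≤) a*size≤))

      A-tight : ∀ h → # (A h) * n G ≡ a * # (NA h)
      A-tight = sum-tight A-ratio (≤-reflexive (≡-sym (proj₁ sums-tight)))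

      D-tight : ∀ g → # (D g) * n G ≡ a * # (ND g)
      D-tight = sum-tight D-ratio (≤-reflexive (≡-sym (proj₂ sums-tight)))

      NA⇒¬ND : ∀ {g h} → NA h g ≡ true → ND g h ≡ false
      NA⇒¬ND {g} {h} g∈NA = ¬-not (NA-ND-disjoint g h g∈NA)

      ND⇒¬NA : ∀ {g h} → ND g h ≡ true → NA h g ≡ false
      ND⇒¬NA {g} {h} h∈ND = ¬-not (λ g∈NA → NA-ND-disjoint g h g∈NA h∈ND)

      ¬NA⇒ND : ∀ {g h} → NA h g ≡ false → ND g h ≡ true
      ¬NA⇒ND {g} {h} g∉NA = ι-injective (trans (≡-sym (cong (λ x → ι x + ι (ND g h)) g∉NA)) (NA+ND≡1 g h))

      ¬ND⇒NA : ∀ {g h} → ND g h ≡ false → NA h g ≡ true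
      ¬ND⇒NA {g} {h} h∉ND = ¬-not λ g∉NA → true≢false (¬NA⇒ND g∉NA) h∉ND

      -- `D g` lies in its closed neighbourhood, so outside `ND g` only the isolated part of `S`
      -- remains.
      ¬ND⇒S≡A : ∀ {g h} → ND g h ≡ false → S g h ≡ A h g
      ¬ND⇒S≡A {g} {h} h∉ND = ∧-false⇒∖ (S g h) (crowded h g) (∨-conicalˡ (D g h) _ h∉ND)

      ¬NA⇒S≡D : ∀ {g h} → NA h g ≡ false → S g h ≡ D g h
      ¬NA⇒S≡D {g} {h} g∉NA = ∖-false⇒∧ (S g h) (crowded h g) (∨-conicalˡ (A h g) _ g∉NA)

      A-full : ∀ h → (∀ g → NA h g ≡ true) → # (A h) ≡ a
      A-full h NA-full = *-cancelʳ-≡ _ _ (n G) (trans (A-tight h) (cong (a *_) (full⇒#≡size NA-full)))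

      A-maximum : ∀ h → # (A h) ≡ a → ∀ g → NA h g ≡ true
      A-maximum h #A = #≡size⇒full (*-cancelˡ-≡ _ _ a (trans (≡-sym (A-tight h)) (cong (_* n G) #A)))

      A-empty : ∀ h → # (A h) ≡ 0 → ∀ g → NA h g ≡ false
      A-empty h #A = #≡0⇒empty (*-cancelˡ-≡ _ 0 a
        (trans (≡-sym (A-tight h)) (trans (cong (_* n G) #A) (≡-sym (*-zeroʳ a)))))

      D-empty : ∀ g → # (D g) ≡ 0 → ∀ h → ND g h ≡ false
      D-empty g #D = #≡0⇒empty (*-cancelˡ-≡ _ 0 a
        (trans (≡-sym (D-tight g)) (trans (cong (_* n G) #D) (≡-sym (*-zeroʳ a)))))

      -- Every fibre has maximum size, and fibres over adjacent vertices have no edges between them,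
      -- so `maximum-agree` identifies them.
      cylinder-over-G : (∀ g h → NA h g ≡ true) →
                        CylinderOverG G H S ⊎ Separated H
      cylinder-over-G NA-full = Sum.map₁
        (λ const → A h₀ , A-ind h₀ , λ g h → trans (¬ND⇒S≡A (NA⇒¬ND (NA-full g h))) (const h g))
        (constant-or-separated H A A-adj h₀)
        where
        A-adj : ∀ h h′ → adj H h h′ ≡ true → A h ≗ A h′
        A-adj h h′ adj-h = maximum-agree G αG (A h) (A h′) (A-ind h) (A-ind h′)
          (A-full h (λ g → NA-full g h)) (A-full h′ (λ g → NA-full g h′))
          λ u v u∈A v∈A adj-uv → S-ind u h v h′ (A⇒S h u u∈A) (A⇒S h′ v v∈A) adj-uv adj-h

      module _ (b≡a : b * n G ≡ a * n H) where

        -- Equal ratios convert tightness against the ratio of `G` into tightness in `H`, as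
        -- imprimitivity of `H` demands.
        D-tightᴴ : ∀ g → # (D g) * n H ≡ b * # (ND g)
        D-tightᴴ g = *-cancelʳ-≡ _ _ (n G) (begin
          # (D g) * n H * n G   ≡⟨ [x*y]*z≡[x*z]*y (# (D g)) (n H) (n G) ⟩
          # (D g) * n G * n H   ≡⟨ cong (_* n H) (D-tight g) ⟩
          a * # (ND g) * n H    ≡⟨ [x*y]*z≡[x*z]*y a (# (ND g)) (n H) ⟩
          a * n H * # (ND g)    ≡⟨ cong (_* # (ND g)) b≡a ⟨
          b * n G * # (ND g)    ≡⟨ [x*y]*z≡[x*z]*y b (n G) (# (ND g)) ⟩
          b * # (ND g) * n G    ∎)
          where open ≡-Reasoning

        D-full : ∀ g → (∀ h → ND g h ≡ true) → # (D g) ≡ b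
        D-full g ND-full =
          *-cancelʳ-≡ _ _ (n H) (trans (D-tightᴴ g) (cong (b *_) (full⇒#≡size ND-full)))

        D-maximum : ∀ g → # (D g) ≡ b → ∀ h → ND g h ≡ true
        D-maximum g #D = #≡size⇒full (*-cancelˡ-≡ _ _ b {{>-nonZero (0<α H αH h₀)}}
          (trans (≡-sym (D-tightᴴ g)) (cong (_* n H) #D)))

        cylinder-over-H : (∀ g h → ND g h ≡ true) →
                          CylinderOverH G H S ⊎ Separated G
        cylinder-over-H ND-full = Sum.map₁
          (λ const → D g₀ , D-ind g₀ , λ g h → trans (¬NA⇒S≡D (ND⇒¬NA (ND-full g h))) (const g h))
          (constant-or-separated G D D-adj g₀)
          where
          D-adj : ∀ g g′ → adj G g g′ ≡ true → D g ≗ D g′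
          D-adj g g′ adj-g = maximum-agree H αH (D g) (D g′) (D-ind g) (D-ind g′)
            (D-full g (ND-full g)) (D-full g′ (ND-full g′))
            λ u v u∈D v∈D → S-ind g u g′ v (D⇒S g u u∈D) (D⇒S g′ v v∈D) adj-g

        -- Row `g₀` decides. Each `NA h` is everything or nothing, hence determined at `g₀`, where
        -- it is complementary to `ND g₀ h`; and `ND g₀` is itself all or nothing.
        one-part-full : (∀ h → # (A h) ≡ 0 ⊎ # (A h) ≡ a) → (∀ g → # (D g) ≡ 0 ⊎ # (D g) ≡ b) →
                        (∀ g h → NA h g ≡ true) ⊎ (∀ g h → ND g h ≡ true)
        one-part-full A-trivial D-trivial = Sum.map row-empty row-full (D-trivial g₀)
          where
          row-empty : # (D g₀) ≡ 0 → ∀ g h → NA h g ≡ true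
          row-empty #D≡0 g h =
            [ (λ #A≡0 → ⊥-elim (true≢false (¬ND⇒NA (D-empty g₀ #D≡0 h)) (A-empty h #A≡0 g₀)))
            , (λ #A≡a → A-maximum h #A≡a g) ] (A-trivial h)

          row-full : # (D g₀) ≡ b → ∀ g h → ND g h ≡ true
          row-full #D≡b g h =
            [ (λ #A≡0 → ¬NA⇒ND (A-empty h #A≡0 g))
            , (λ #A≡a → ⊥-elim (true≢false (A-maximum h #A≡a g₀) (ND⇒¬NA (D-maximum g₀ #D≡b h)))) ] (A-trivial h)

        cylinder-or-imprimitive :
          (CylinderOverG G H S ⊎ CylinderOverH G H S) ⊎ (ISImprimitive G ⊎ ISImprimitive H)
        cylinder-or-imprimitive = combined
          (trivial-or-imprimitive G isαG A A-ind A-tight)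
          (trivial-or-imprimitive H isαH D D-ind D-tightᴴ)
          where
          combined : (∀ h → # (A h) ≡ 0 ⊎ # (A h) ≡ a) ⊎ ISImprimitive G →
                     (∀ g → # (D g) ≡ 0 ⊎ # (D g) ≡ b) ⊎ ISImprimitive H →
                     (CylinderOverG G H S ⊎ CylinderOverH G H S) ⊎ (ISImprimitive G ⊎ ISImprimitive H)
          combined (inj₂ imprim)    _                = inj₂ (inj₁ imprim)
          combined (inj₁ _)         (inj₂ imprim)    = inj₂ (inj₂ imprim)
          combined (inj₁ A-trivial) (inj₁ D-trivial) =
            [ (λ NA-full → Sum.map inj₁ (inj₂ ∘ separated⇒imprimitive H isαH vtH) (cylinder-over-G NA-full))
            , (λ ND-full → Sum.map inj₂ (inj₁ ∘ separated⇒imprimitive G isαG vtG) (cylinder-over-H ND-full))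
            ] (one-part-full A-trivial D-trivial)

      -- `D-tight` makes `D g` attain the ratio of `G`, while `D-ratioᴴ` allows only the smaller
      -- ratio of `H`; so `ND g` is empty.
      strict⇒NA-full : b * n G < a * n H → ∀ g h → NA h g ≡ true
      strict⇒NA-full b<a g h = ¬ND⇒NA (#≡0⇒empty (vanishes (# (ND g)) refl) h)
        where
        -- Naming the size `r` exposes it as a successor, the positive factor that the strict step
        -- requires.
        vanishes : ∀ r → # (ND g) ≡ r → # (ND g) ≡ 0
        vanishes zero    eq = eq
        vanishes (suc r) eq = ⊥-elim (<-irrefl refl (begin-strict
          # (D g) * n G * n H   ≡⟨ [x*y]*z≡[x*z]*y (# (D g)) (n G) (n H) ⟩
          # (D g) * n H * n G   ≤⟨ *-monoˡ-≤ (n G) (D-ratioᴴ g) ⟩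
          b * # (ND g) * n G    ≡⟨ [x*y]*z≡[x*z]*y b (# (ND g)) (n G) ⟩
          b * n G * # (ND g)    ≡⟨ cong (b * n G *_) eq ⟩
          b * n G * suc r       <⟨ *-monoˡ-< (suc r) b<a ⟩
          a * n H * suc r       ≡⟨ cong (a * n H *_) eq ⟨
          a * n H * # (ND g)    ≡⟨ [x*y]*z≡[x*z]*y a (n H) (# (ND g)) ⟩
          a * # (ND g) * n H    ≡⟨ cong (_* n H) (D-tight g) ⟨
          # (D g) * n G * n H   ∎))
          where open ≤-Reasoning

-- Transfer to the encoded product

module _ (G H : Graph) where

  curryᶠ : {A : Set} → (Fin (n G * n H) → A) → Fin (n G) → Fin (n H) → A
  curryᶠ f g h = f (combine g h)

  ×ᵍ-adj : ∀ g h g′ h′ → adj (G ×ᵍ H) (combine g h) (combine g′ h′) ≡ adj G g g′ ∧ adj H h h′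
  ×ᵍ-adj g h g′ h′ =
    cong₂ (λ p q → adj G (proj₁ p) (proj₁ q) ∧ adj H (proj₂ p) (proj₂ q))
      (remQuot-combine g h) (remQuot-combine g′ h′)

  curryᶠ-ind : ∀ P → Indep (G ×ᵍ H) P → ∀ g h g′ h′ → curryᶠ P g h ≡ true → curryᶠ P g′ h′ ≡ true →
               adj G g g′ ≡ true → adj H h h′ ≢ true
  curryᶠ-ind P P-ind g h g′ h′ p p′ adj-g adj-h =
    P-ind _ _ p p′ (trans (×ᵍ-adj g h g′ h′) (cong₂ _∧_ adj-g adj-h))

  cylinder : (Fin (n G) → Bool) → Fin (n G * n H) → Bool
  cylinder I x = I (proj₁ (remQuot {n G} (n H) x))

  curryᶠ-cylinder : ∀ I g h → curryᶠ (cylinder I) g h ≡ I g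
  curryᶠ-cylinder I g h = cong (I ∘ proj₁) (remQuot-combine g h)

  #-cylinder : ∀ I → # (cylinder I) ≡ # I * n H
  #-cylinder I = begin
    # (cylinder I)                           ≡⟨ sum-combine (n G) (n H) (ι ∘ cylinder I) ⟩
    sum (λ g → # (curryᶠ (cylinder I) g))
      ≡⟨ sum-cong-≗ (λ g → #-cong {P = curryᶠ (cylinder I) g} {Q = λ _ → I g} (curryᶠ-cylinder I g)) ⟩
    sum (λ g → sum {n H} (λ _ → ι (I g)))
      ≡⟨ sum-cong-≗ (λ g → trans (sum-const (n H) (ι (I g))) (*-comm (n H) (ι (I g)))) ⟩
    sum (λ g → ι (I g) * n H)                ≡⟨ *-distribʳ-sum (n H) (ι ∘ I) ⟨
    # I * n H                                ∎
    where open ≡-Reasoning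

  cylinder-ind : ∀ I → Indep G I → Indep (G ×ᵍ H) (cylinder I)
  cylinder-ind I I-ind x y x∈ y∈ adj-xy = I-ind _ _ x∈ y∈ (∧-conicalˡ _ _ adj-xy)

  NormalSet : Subset (n G * n H) → Set
  NormalSet S =
      (Σ (Subset (n G)) λ I → Independent G I
          × (∀ g h → (combine {n G} {n H} g h ∈ S) ⇔ (g ∈ I)))
    ⊎ (Σ (Subset (n H)) λ J → Independent H J
          × (∀ g h → (combine {n G} {n H} g h ∈ S) ⇔ (h ∈ J)))

  ∈-tabulate : ∀ (S : Subset (n G * n H)) (P : Fin m → Bool) x i → lookup S x ≡ P i →
               (x ∈ S) ⇔ (i ∈ tabulate P)
  ∈-tabulate S P x i eq = mk⇔
    (λ x∈S → lookup⇒[]= i _ (trans (lookup∘tabulate P i) (trans (≡-sym eq) ([]=⇒lookup x∈S))))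
    (λ i∈P → lookup⇒[]= x S (trans eq (trans (≡-sym (lookup∘tabulate P i)) ([]=⇒lookup i∈P))))

  normal-over-G : ∀ S → CylinderOverG G H (curryᶠ (lookup S)) → NormalSet S
  normal-over-G S (I , I-ind , eq) =
    inj₁ (tabulate I , Indep⇒Independent G I I-ind , λ g h → ∈-tabulate S I _ g (eq g h))

  normal-over-H : ∀ S → CylinderOverH G H (curryᶠ (lookup S)) → NormalSet S
  normal-over-H S (J , J-ind , eq) =
    inj₂ (tabulate J , Indep⇒Independent H J J-ind , λ g h → ∈-tabulate S J _ h (eq g h))

  module _
    (g₀ : Fin (n G)) (h₀ : Fin (n H)) (vtG : VertexTransitive G) (vtH : VertexTransitive H)
    {a b : ℕ} (isαG : IsAlpha G a) (isαH : IsAlpha H b) (b≤a : b * n G ≤ a * n H)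
    where

    private
      module Bounded (P : Fin (n G * n H) → Bool) (P-ind : Indep (G ×ᵍ H) P) =
        Decomposition.Bound G H (curryᶠ P) (curryᶠ-ind P P-ind) g₀ h₀ vtG vtH isαG isαH b≤a

    -- The cylinder over a maximum independent set of `G` attains the upper bound.
    α-×ᵍ : IsAlpha (G ×ᵍ H) (a * n H)
    α-×ᵍ = tabulate C , (Indep⇒Independent (G ×ᵍ H) C C-ind , maximal) , size
      where
      open Alpha (IsAlpha⇒Alpha G isαG)

      C : Fin (n G * n H) → Bool
      C = cylinder I

      C-ind : Indep (G ×ᵍ H) C
      C-ind = cylinder-ind I I-indep

      size : ∣ tabulate C ∣ ≡ a * n H
      size = trans (∣tabulate∣≡# C) (trans (#-cylinder I) (cong (_* n H) #I))

      maximal : ∀ B → Independent (G ×ᵍ H) B → ∣ B ∣ ≤ ∣ tabulate C ∣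
      maximal B B-ind = begin
        ∣ B ∣                                    ≡⟨ ∣∣≡# B ⟩
        # (lookup B)                             ≡⟨ sum-combine (n G) (n H) (ι ∘ lookup B) ⟩
        sum (λ g → # (curryᶠ (lookup B) g))      ≤⟨ Bounded.bound (lookup B) (Independent⇒Indep (G ×ᵍ H) B B-ind) ⟩
        a * n H                                  ≡⟨ size ⟨
        ∣ tabulate C ∣                           ∎
        where open ≤-Reasoning

    IsMaxIndep⇒MaxIndep : ∀ S → IsMaxIndep (G ×ᵍ H) S → MaxIndep (G ×ᵍ H) (a * n H) (lookup S)
    IsMaxIndep⇒MaxIndep S (S-ind , S-max) = Independent⇒Indep (G ×ᵍ H) S S-ind , size α-×ᵍ
      where
      size : ∀ {k} → IsAlpha (G ×ᵍ H) k → # (lookup S) ≡ k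
      size (T , (T-ind , T-max) , ∣T∣) =
        trans (≡-sym (∣∣≡# S)) (trans (≤-antisym (T-max S S-ind) (S-max T T-ind)) ∣T∣)

    -- Being maximum is decidable, and other sets satisfy the implication in `MISNormal` vacuously,
    -- so the search over all subsets applies.
    normal-or : {Q : Set} → (∀ S → MaxIndep (G ×ᵍ H) (a * n H) (lookup S) → NormalSet S ⊎ Q) →
                MISNormal G H ⊎ Q
    normal-or {Q} f = ∀Subset-⊎ λ S → cases S (maxIndep? (G ×ᵍ H) (a * n H) (lookup S))
      where
      cases : ∀ S → Dec (MaxIndep (G ×ᵍ H) (a * n H) (lookup S)) →
              (IsMaxIndep (G ×ᵍ H) S → NormalSet S) ⊎ Q
      cases S (yes max) = Sum.map₁ (λ normal _ → normal) (f S max)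
      cases S (no ¬max) = inj₁ (λ max → ⊥-elim (¬max (IsMaxIndep⇒MaxIndep S max)))

    module _ (S : Subset (n G * n H)) (max : MaxIndep (G ×ᵍ H) (a * n H) (lookup S)) where

      private
        module E = Bounded.Extremal (lookup S) (proj₁ max)
          (≤-reflexive (trans (≡-sym (proj₂ max)) (sum-combine (n G) (n H) (ι ∘ lookup S))))

      normal-or-disconnected : b * n G < a * n H → NormalSet S ⊎ Disconnected H
      normal-or-disconnected b<a =
        Sum.map (normal-over-G S) (separated⇒disconnected H) (E.cylinder-over-G (E.strict⇒NA-full b<a))

      normal-or-imprimitive : b * n G ≡ a * n H → NormalSet S ⊎ (ISImprimitive G ⊎ ISImprimitive H)
      normal-or-imprimitive b≡a =
        Sum.map₁ [ normal-over-G S , normal-over-H S ] (E.cylinder-or-imprimitive b≡a)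

theorem1p8 : (G H : Graph) → 0 < n G → 0 < n H
    → VertexTransitive G → VertexTransitive H
    → (a b : ℕ) → IsAlpha G a → IsAlpha H b
    → b * n G ≤ a * n H
    → IsAlpha (G ×ᵍ H) (a * n H)
    × (MISNormal G H
    ⊎ (b * n G ≡ a * n H × (ISImprimitive G ⊎ ISImprimitive H))
    ⊎ (b * n G < a * n H × Disconnected H))
theorem1p8 G H 0<nG 0<nH vtG vtH a b isαG isαH b≤a =
  α-×ᵍ G H g₀ h₀ vtG vtH isαG isαH b≤a ,
  -- Strict ratios lead to disjunct (iii), equal ratios to disjunct (ii).
  [ (λ b<a → Sum.map₂ (λ disc → inj₂ (b<a , disc))
      (normal-or G H g₀ h₀ vtG vtH isαG isαH b≤a λ S max →
        normal-or-disconnected G H g₀ h₀ vtG vtH isαG isαH b≤a S max b<a))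
  , (λ b≡a → Sum.map₂ (λ imprim → inj₁ (b≡a , imprim))
      (normal-or G H g₀ h₀ vtG vtH isαG isαH b≤a λ S max →
        normal-or-imprimitive G H g₀ h₀ vtG vtH isαG isαH b≤a S max b≡a))
  ] (m≤n⇒m<n∨m≡n b≤a)
  where
  g₀ = fromℕ< 0<nG
  h₀ = fromℕ< 0<nH
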